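{- Let $n\ge 1$, $k\ge 1$ be integers, let $\lambda^{(1)},\dots,\lambda^{(2k)}\in\mathbb Z^n$ be decreasing vectors, and fix $i_1\in\{1,\dots,n\}$. Then $$\mathfrak D_{\lambda^{(1)},\dots,\lambda^{(2k)}}=\sum_{I}(-1)^{i_1+\dots+i_{2k}}\,\mathfrak D_{\mu^{(1)}_I,\dots,\mu^{(2k)}_I},$$ where the sum is over the $2k$-tuples $I=[i_1,i_2,\dots,i_{2k}]\in\{1,\dots,n\}^{2k}$ whose first entry is the fixed $i_1$ and which satisfy $$\lambda^{(1)}_{n-i_1+1}+\dots+\lambda^{(2k)}_{n-i_{2k}+1}+i_1+\dots+i_{2k}=(2k-1)n+1,$$ and the decreasing vectors $\mu^{(1)}_I,\dots,\mu^{(2k)}_I\in\mathbb Z^{n-1}$ are defined by $$\mu_I^{(1)}=[\lambda_1^{(1)}-2(k-1),\dots,\lambda_{n-i_1}^{(1)}-2(k-1),\ \lambda_{n-i_1+2}^{(1)}-2(k-1)-1,\dots,\lambda_n^{(1)}-2(k-1)-1]$$ and, for $2\le j\le 2k$, $$\mu_I^{(j)}=[\lambda_1^{(j)}+1,\dots,\lambda_{n-i_j}^{(j)}+1,\ \lambda_{n-i_j+2}^{(j)},\dots,\lambda_n^{(j)}].$$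
   Context: For a tensor $\mathrm M=(M_{i_1,\dots,i_{2k}})_{1\le i_1,\dots,i_{2k}\le n}$, the hyperdeterminant is $$\mathrm{Det}(\mathrm M)=\frac1{n!}\sum_{\sigma_1,\dots,\sigma_{2k}\in\mathfrak S_n}\mathrm{sign}(\sigma_1\cdots\sigma_{2k})\prod_{i=1}^n M_{\sigma_1(i),\dots,\sigma_{2k}(i)},$$ where $\mathfrak S_n$ is the symmetric group (so it equals $1$ when $n=0$). A vector $\lambda=[\lambda_1,\dots,\lambda_n]\in\mathbb Z^n$ is called decreasing if $\lambda_1\ge\dots\ge\lambda_n$. For $2k$ decreasing vectors $\lambda^{(1)},\dots,\lambda^{(2k)}\in\mathbb Z^n$, define $$\Delta_{\lambda^{(1)},\dots,\lambda^{(2k)}}=\left(\delta_{\lambda^{(1)}_{n-i_1+1}+\dots+\lambda^{(2k)}_{n-i_{2k}+1}+i_1+\dots+i_{2k},\,(2k-1)n+1}\right)_{1\le i_1,\dots,i_{2k}\le n}$$ ($\delta$ is the Kronecker delta) and $\mathfrak D_{\lambda^{(1)},\dots,\lambda^{(2k)}}=\mathrm{Det}(\Delta_{\lambda^{(1)},\dots,\lambda^{(2k)}})$. The same definition with $n$ replaced by $n-1$ is used for vectors in $\mathbb Z^{n-1}$. -}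

module Defs where

import Algebra.Properties.CommutativeMonoid.Sum as Sum
open import Data.Bool.Base using (if_then_else_)
open import Data.Fin.Base as Fin using (Fin; zero; suc; toℕ; inject₁; opposite)
import Data.Fin.Properties as Fin
open import Data.Fin.Permutation as Perm using (Permutation′; _⟨$⟩ʳ_; _∘ₚ_; insert; remove)
open import Data.Integer.Base as ℤ using (ℤ; +_; 1ℤ; -1ℤ)
import Data.Integer.Properties as ℤ
open import Data.List.Base as List using (List; []; _∷_)
import Data.List.Membership.Propositional.Properties as Mem
open import Data.List.Relation.Unary.All as All using (All; []; _∷_)
import Data.List.Relation.Unary.All.Properties as All
open import Data.List.Relation.Unary.AllPairs as AllPairs using (AllPairs; []; _∷_)
import Data.List.Relation.Unary.AllPairs.Properties as AllPairs
open import Data.List.Relation.Unary.Any as Any using (Any; here; there)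
import Data.List.Relation.Unary.Any.Properties as Any
import Data.List.Relation.Unary.Unique.Propositional.Properties as Unique
open import Data.Nat.Base as ℕ using (ℕ; zero; suc; _!)
import Data.Nat.Properties as ℕ
open import Data.Product.Base using (_,_)
open import Data.Rational.Base as ℚ using (ℚ; 0ℚ; 1ℚ)
import Data.Rational.Properties as ℚ
open import Data.Vec.Base as Vec using (Vec; []; _∷_)
open import Function.Base using (_∘_)
open import Relation.Binary.PropositionalEquality
  using (_≡_; _≢_; refl; sym; trans; cong; subst; setoid)
open import Relation.Nullary.Decidable using (yes; no; does; _×-dec_)
open import Relation.Nullary.Negation using (¬_; contradiction)

∑ : {A : Set} → List A → (A → ℚ) → ℚ
∑ xs f = List.foldr ℚ._+_ 0ℚ (List.map f xs)

∏ : ∀ {n} → (Fin n → ℚ) → ℚ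
∏ = Sum.sum ℚ.*-1-commutativeMonoid

tuples : {A : Set} → List A → ∀ d → List (Vec A d)
tuples xs zero    = [] ∷ []
tuples xs (suc d) = List.cartesianProductWith _∷_ xs (tuples xs d)

-- insert zero j π sends zero to j and otherwise acts like π; the two lemmas below
-- say that this enumerates the symmetric group without repetition.
permutations : ∀ n → List (Permutation′ n)
permutations zero    = Perm.id ∷ []
permutations (suc n) = List.cartesianProductWith (insert zero) (List.allFin (suc n)) (permutations n)

permutations-complete : ∀ {n} (π : Permutation′ n) → Any (π Perm.≈_) (permutations n)
permutations-complete {zero}  π = here λ ()
permutations-complete {suc n} π =
  Any.cartesianProductWith⁺ (insert zero) agree
    (Mem.∈-allFin (π ⟨$⟩ʳ zero)) (permutations-complete (remove zero π))
  where
  agree : ∀ {j ρ} → π ⟨$⟩ʳ zero ≡ j → remove zero π Perm.≈ ρ → π Perm.≈ insert zero j ρ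
  agree refl π≈ρ zero    = refl
  agree refl π≈ρ (suc i) = trans (sym (Perm.insert-remove zero π (suc i)))
    (cong (Fin.punchIn (π ⟨$⟩ʳ zero)) (π≈ρ i))

permutations-unique : ∀ n → AllPairs (λ π ρ → ¬ π Perm.≈ ρ) (permutations n)
permutations-unique zero    = [] ∷ []
permutations-unique (suc n) = go (Unique.allFin⁺ (suc n))
  where
  go : ∀ {js} → AllPairs _≢_ js → AllPairs (λ π ρ → ¬ π Perm.≈ ρ)
       (List.cartesianProductWith (insert zero) js (permutations n))
  go []              = []
  go {j ∷ js} (j∉js ∷ js!) = AllPairs.++⁺
    (AllPairs.map⁺ (AllPairs.map
      (λ π≉ρ eq → π≉ρ λ i → Fin.punchIn-injective j _ _ (eq (suc i)))
      (permutations-unique n)))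
    (go js!)
    (All.map⁺ (All.universal
      (λ _ → All.cartesianProductWith⁺ (setoid _) (setoid _) (insert zero) js (permutations n)
        (λ k∈js _ eq → All.lookup j∉js k∈js (eq zero)))
      (permutations n)))

inversions : ∀ {n} → Permutation′ n → ℕ
inversions {n} σ = List.length (List.filter
  (λ (i , j) → (i Fin.<? j) ×-dec ((σ ⟨$⟩ʳ j) Fin.<? (σ ⟨$⟩ʳ i)))
  (List.cartesianProduct (List.allFin n) (List.allFin n)))

sign : ∀ {n} → Permutation′ n → ℤ
sign σ = -1ℤ ℤ.^ inversions σ

-- _∘ₚ_ applies its left argument first, whereas in σ₁ ⋯ σ_d the rightmost
-- factor is applied first.
compose : ∀ {d n} → Vec (Permutation′ n) d → Permutation′ n
compose = Vec.foldr _ (λ σ τ → τ ∘ₚ σ) Perm.id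

Tensor : ℕ → ℕ → Set
Tensor d n = Vec (Fin n) d → ℚ

Det : ∀ {d n} → Tensor d n → ℚ
Det {d} {n} M = ((1ℤ ℚ./ (n !)) {{n ℕ.!≢0}}) ℚ.*
  ∑ (tuples (permutations n) d) λ σs →
    (sign (compose σs) ℚ./ 1) ℚ.* ∏ λ i → M (Vec.map (_⟨$⟩ʳ i) σs)

record DecreasingVector (n : ℕ) : Set where
  field
    entry      : Fin n → ℤ
    decreasing : ∀ {p q} → p Fin.≤ q → entry q ℤ.≤ entry p
open DecreasingVector public

δ : ℤ → ℤ → ℚ
δ x y = if does (x ℤ.≟ y) then 1ℚ else 0ℚ

-- i : Fin n stands for the 1-based index toℕ i + 1.
indexSum : ∀ {d n} → Vec (Fin n) d → ℕ
indexSum I = Vec.sum (Vec.map (suc ∘ toℕ) I)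

-- λ⁽¹⁾_{n-i₁+1} + ⋯ + λ⁽ᵈ⁾_{n-i_d+1} + i₁ + ⋯ + i_d; the position n-i+1 is
-- opposite i.
weight : ∀ {d n} → (Fin d → DecreasingVector n) → Vec (Fin n) d → ℤ
weight λs I =
  Sum.sum ℤ.+-0-commutativeMonoid (λ j → entry (λs j) (opposite (Vec.lookup I j)))
  ℤ.+ + indexSum I

target : ℕ → ℕ → ℤ
target k n = (+ 2 ℤ.* + k ℤ.- 1ℤ) ℤ.* + n ℤ.+ 1ℤ

Δ : ∀ k {n} → (Fin (2 ℕ.* k) → DecreasingVector n) → Tensor (2 ℕ.* k) n
Δ k {n} λs I = δ (weight λs I) (target k n)

𝔇 : ∀ k {n} → (Fin (2 ℕ.* k) → DecreasingVector n) → ℚ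
𝔇 k λs = Det (Δ k λs)

-- [v₁ + a, …, v_{r-1} + a, v_{r+1} + b, …, v_{n+1} + b], where r is the 1-based
-- position of the deleted entry.
deleteAndShift : ∀ {n} (a b : ℤ) → b ℤ.≤ a →
                 Fin (suc n) → DecreasingVector (suc n) → DecreasingVector n
deleteAndShift {n} a b b≤a r v = record { entry = e ; decreasing = dec }
  where
  e : Fin n → ℤ
  e p with toℕ p ℕ.<? toℕ r
  ... | yes _ = entry v (inject₁ p) ℤ.+ a
  ... | no  _ = entry v (suc p) ℤ.+ b

  inject₁-mono : ∀ {p q : Fin n} → p Fin.≤ q → inject₁ p Fin.≤ inject₁ q
  inject₁-mono {p} {q} p≤q rewrite Fin.toℕ-inject₁ p | Fin.toℕ-inject₁ q = p≤q

  dec : ∀ {p q} → p Fin.≤ q → e q ℤ.≤ e p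
  dec {p} {q} p≤q with toℕ p ℕ.<? toℕ r | toℕ q ℕ.<? toℕ r
  ... | yes _  | yes _  = ℤ.+-monoˡ-≤ a (decreasing v (inject₁-mono p≤q))
  ... | yes _  | no _   = ℤ.+-mono-≤
    (decreasing v (subst (ℕ._≤ suc (toℕ q)) (sym (Fin.toℕ-inject₁ p)) (ℕ.m≤n⇒m≤1+n p≤q))) b≤a
  ... | no p≮r | yes q<r = contradiction (ℕ.≤-<-trans p≤q q<r) p≮r
  ... | no _   | no _   = ℤ.+-monoˡ-≤ b (decreasing v (ℕ.s≤s p≤q))

-- The parameter is k - 1, so that the family has 2k members; n - iⱼ entries
-- precede the deleted one, which is therefore at position opposite iⱼ.
μ : ∀ k-1 {n} → (Fin (2 ℕ.* suc k-1) → DecreasingVector (suc n)) →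
    Vec (Fin (suc n)) (2 ℕ.* suc k-1) → Fin (2 ℕ.* suc k-1) → DecreasingVector n
μ k-1 λs I zero    = deleteAndShift c (c ℤ.- 1ℤ) (ℤ.i-j≤i c 1ℤ)
  (opposite (Vec.lookup I zero)) (λs zero)
  where c = ℤ.- (+ 2 ℤ.* + k-1)
μ k-1 λs I (suc j) = deleteAndShift 1ℤ (+ 0) (ℤ.+≤+ ℕ.z≤n)
  (opposite (Vec.lookup I (suc j))) (λs (suc j))

admissible : ∀ k-1 {n} → (Fin (2 ℕ.* suc k-1) → DecreasingVector (suc n)) →
             Fin (suc n) → List (Vec (Fin (suc n)) (2 ℕ.* suc k-1))
admissible k-1 {n} λs i₁ = List.filter
  (λ I → (Vec.head I Fin.≟ i₁) ×-dec (weight λs I ℤ.≟ target (suc k-1) (suc n)))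
  (tuples (List.allFin (suc n)) (2 ℕ.* suc k-1))

{-# OPTIONS --safe #-}
-- Laplace expansion of a hyperdeterminant of even order along its first index. For each
-- position p, keep the terms with σ₁(p) = i₁ and write σⱼ = insert p iⱼ ρⱼ. Since
-- sign (insert p i ρ) = (-1)^(p+i) sign ρ and p contributes 2k times, the resulting sum
-- over I and the ρⱼ does not depend on p; summing over the n positions turns 1/n! into
-- 1/(n-1)!. For Δ, removing the slices I shifts the weight and the target
-- alike by 2k - 1, so the minor is the Δ of the vectors μ.
module Submission where

open import Defs
import Algebra.Properties.CommutativeMonoid.Sum as Sum
open import Data.Bool.Base using (if_then_else_; true; false)
open import Data.Fin.Base as Fin using (Fin; zero; suc; toℕ; inject₁; opposite; punchIn)
import Data.Fin.Properties as Fin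
open import Data.Fin.Permutation as Perm using (Permutation′; _⟨$⟩ʳ_; _∘ₚ_; insert; remove)
open import Data.Integer.Base as ℤ using (ℤ; +_; 1ℤ; -1ℤ; _^_)
import Data.Integer.Properties as ℤ
import Data.Integer.Solver as ℤSolver
open import Data.List.Base as List using (List; []; _∷_)
import Data.List.Properties as List
open import Data.Nat.Base as ℕ using (ℕ; zero; suc; _*_; _!)
import Data.Nat.Properties as ℕ
import Data.Nat.Solver as ℕSolver
open import Data.Product.Base using (_×_; _,_; map)
open import Data.Rational.Base as ℚ using (ℚ; 0ℚ; 1ℚ; _/_)
import Data.Rational.Properties as ℚ
import Data.Rational.Solver as ℚSolver
open import Data.Rational.Unnormalised.Base as ℚᵘ using (mkℚᵘ; *≡*)
import Data.Rational.Unnormalised.Properties as ℚᵘ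
open import Data.Vec.Base as Vec using (Vec; []; _∷_)
import Data.Vec.Properties as Vec
open import Data.Vec.Relation.Binary.Pointwise.Inductive as Pointwise using (Pointwise; []; _∷_)
open import Function.Base using (_∘_; id)
open import Function.Bundles using (mk⇔)
open import Relation.Binary.Definitions using (Tri; tri<; tri≈; tri>)
open import Relation.Binary.PropositionalEquality
  using (_≡_; refl; sym; trans; cong; cong₂; subst₂; module ≡-Reasoning)
open import Relation.Nullary.Decidable
  using (Dec; yes; no; does; _×-dec_; does-⇔; dec-true; dec-false)
open import Relation.Nullary.Negation using (¬_; contradiction)
open import Relation.Unary using (Decidable)

open ≡-Reasoning

open Sum ℕ.+-0-commutativeMonoid using ()
  renaming (sum to ∑ℕ; sum-remove to ∑ℕ-remove; sum-cong-≗ to ∑ℕ-cong;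
            ∑-distrib-+ to ∑ℕ-distrib-+; ∑-permute to ∑ℕ-permute)
open Sum ℤ.+-0-commutativeMonoid using ()
  renaming (sum to ∑ℤ; sum-cong-≗ to ∑ℤ-cong; ∑-distrib-+ to ∑ℤ-distrib-+)
open Sum ℚ.*-1-commutativeMonoid using ()
  renaming (sum-remove to ∏-remove; sum-cong-≗ to ∏-cong)
open import Algebra.Properties.AbelianGroup ℤ.+-0-abelianGroup using (∙-cancelʳ)

-- Two obstacles shape the proof. First, `sign` counts inversions, so neither its value on
-- `insert p i ρ` nor its multiplicativity is immediate. Removing one point from a permutation is
-- analysed first, modulo 2, and multiplicativity then follows by induction on the number of points.
-- Second, permutations are records of functions and are compared only pointwise, by `Perm._≈_`. The
-- list `permutations (suc n)` inserts at `zero`; insertion at another `p` lists the same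
-- permutations in another order and only up to `≈`. Sums are therefore carried from one list to the
-- other by counting with 0/1 indicators, and every summand has to be shown to respect `≈`. The sum
-- over all positions is forced by the shape of `Det`: for a single `p` the condition σ₁(p) = i₁
-- retains only some of the terms, but each σ₁ takes the value i₁ at exactly one `p`.

⟦_⟧ : {P : Set} → Dec P → ℕ
⟦ p? ⟧ = if does p? then 1 else 0

⟦⟧-cong : {P Q : Set} (p? : Dec P) (q? : Dec Q) → (P → Q) → (Q → P) → ⟦ p? ⟧ ≡ ⟦ q? ⟧
⟦⟧-cong p? q? f g = cong (if_then 1 else 0) (does-⇔ (mk⇔ f g) p? q?)

private variable
  A B C : Set
  m n d : ℕ

-- Inversion numbers as double sums of indicators.

length-filter-++ : {P : A → Set} (P? : Decidable P) (xs ys : List A) →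
  List.length (List.filter P? (xs List.++ ys)) ≡
  List.length (List.filter P? xs) ℕ.+ List.length (List.filter P? ys)
length-filter-++ P? [] ys = refl
length-filter-++ P? (x ∷ xs) ys with does (P? x)
... | true  = cong suc (length-filter-++ P? xs ys)
... | false = length-filter-++ P? xs ys

length-filter-map-tabulate : {P : B → Set} (P? : Decidable P) (g : A → B) (f : Fin n → A) →
  List.length (List.filter P? (List.map g (List.tabulate f))) ≡ ∑ℕ (λ i → ⟦ P? (g (f i)) ⟧)
length-filter-map-tabulate {n = zero}  P? g f = refl
length-filter-map-tabulate {n = suc n} P? g f with does (P? (g (f zero)))
... | true  = cong suc (length-filter-map-tabulate P? g (f ∘ suc))
... | false = length-filter-map-tabulate P? g (f ∘ suc)

-- Arbitrary `f` and `g` stand where `id` is used in the end, because the tail of `tabulate f` is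
-- `tabulate (f ∘ suc)` and the induction has to pass through it.
length-filter-product : {P : A × B → Set} (P? : Decidable P) (f : Fin m → A) (g : Fin n → B) →
  List.length (List.filter P? (List.cartesianProduct (List.tabulate f) (List.tabulate g))) ≡
  ∑ℕ (λ i → ∑ℕ λ j → ⟦ P? (f i , g j) ⟧)
length-filter-product {m = zero}  P? f g = refl
length-filter-product {m = suc m} P? f g = trans
  (length-filter-++ P? (List.map (f zero ,_) (List.tabulate g)) _)
  (cong₂ ℕ._+_ (length-filter-map-tabulate P? (f zero ,_) g)
               (length-filter-product P? (f ∘ suc) g))

∑ℕ-0 : ∀ n → ∑ℕ {n} (λ _ → 0) ≡ 0
∑ℕ-0 zero    = refl
∑ℕ-0 (suc n) = ∑ℕ-0 n

∑ℕ-< : (p : Fin n) → ∑ℕ {n} (λ j → ⟦ j Fin.<? p ⟧) ≡ toℕ p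
∑ℕ-< {suc n} zero    = ∑ℕ-0 n
∑ℕ-< {suc n} (suc p) = cong suc (∑ℕ-< p)

-- Removing a point: its effect on inversions and sign.

punchIn-mono-< : ∀ (p : Fin (suc n)) {i j} → i Fin.< j → punchIn p i Fin.< punchIn p j
punchIn-mono-< p i<j = ℕ.≰⇒> (ℕ.<⇒≱ i<j ∘ Fin.punchIn-cancel-≤ p _ _)

punchIn-cancel-< : ∀ (p : Fin (suc n)) {i j} → punchIn p i Fin.< punchIn p j → i Fin.< j
punchIn-cancel-< p pi<pj = ℕ.≰⇒> (ℕ.<⇒≱ pi<pj ∘ Fin.punchIn-mono-≤ p _ _)

inverted? : (σ : Permutation′ n) (i j : Fin n) → Dec (i Fin.< j × σ ⟨$⟩ʳ j Fin.< σ ⟨$⟩ʳ i)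
inverted? σ i j = (i Fin.<? j) ×-dec ((σ ⟨$⟩ʳ j) Fin.<? (σ ⟨$⟩ʳ i))

inversions-∑ℕ : (σ : Permutation′ n) → inversions σ ≡ ∑ℕ λ i → ∑ℕ λ j → ⟦ inverted? σ i j ⟧
inversions-∑ℕ {n} σ = length-filter-product (λ (i , j) → inverted? σ i j) id id

inverted-remove : (p : Fin (suc n)) (σ : Permutation′ (suc n)) (i j : Fin n) →
  ⟦ inverted? σ (punchIn p i) (punchIn p j) ⟧ ≡ ⟦ inverted? (remove p σ) i j ⟧
inverted-remove p σ i j = ⟦⟧-cong (inverted? σ (punchIn p i) (punchIn p j)) (inverted? (remove p σ) i j)
  (map (punchIn-cancel-< p) (punchIn-cancel-< (σ ⟨$⟩ʳ p) ∘ subst₂ Fin._<_ (at j) (at i)))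
  (map (punchIn-mono-< p) (subst₂ Fin._<_ (sym (at j)) (sym (at i)) ∘ punchIn-mono-< (σ ⟨$⟩ʳ p)))
  where at = Perm.punchIn-permute σ p

inverted-irrefl : (σ : Permutation′ n) (p : Fin n) → ⟦ inverted? σ p p ⟧ ≡ 0
inverted-irrefl σ p =
  cong (if_then 1 else 0) (dec-false (inverted? σ p p) λ (p<p , _) → ℕ.<-irrefl refl p<p)

-- The row and the column of `p` are split off the double sum. What remains counts the inversions of
-- `remove p σ`, since `punchIn` preserves and reflects order on both sides. The diagonal pair (p,
-- p) counts 0, so the row and the column can both run over all `j` and merge into one sum.
inversions-remove : (p : Fin (suc n)) (σ : Permutation′ (suc n)) →
  inversions σ ≡ ∑ℕ (λ j → ⟦ inverted? σ p j ⟧ ℕ.+ ⟦ inverted? σ j p ⟧) ℕ.+ inversions (remove p σ)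
inversions-remove {n} p σ = begin
  inversions σ
    ≡⟨ inversions-∑ℕ σ ⟩
  ∑ℕ (λ i → ∑ℕ (t i))
    ≡⟨ ∑ℕ-remove {i = p} (λ i → ∑ℕ (t i)) ⟩
  ∑ℕ (t p) ℕ.+ ∑ℕ (λ i → ∑ℕ (t (punchIn p i)))
    ≡⟨ cong (∑ℕ (t p) ℕ.+_) (∑ℕ-cong λ i → trans (∑ℕ-remove {i = p} (t (punchIn p i)))
         (cong (t (punchIn p i) p ℕ.+_) (∑ℕ-cong (inverted-remove p σ i)))) ⟩
  ∑ℕ (t p) ℕ.+ ∑ℕ (λ i → t (punchIn p i) p ℕ.+ ∑ℕ (t′ i))
    ≡⟨ cong (∑ℕ (t p) ℕ.+_) (∑ℕ-distrib-+ (λ i → t (punchIn p i) p) _) ⟩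
  ∑ℕ (t p) ℕ.+ (∑ℕ (λ i → t (punchIn p i) p) ℕ.+ ∑ℕ (λ i → ∑ℕ (t′ i)))
    ≡⟨ ℕ.+-assoc (∑ℕ (t p)) _ _ ⟨
  ∑ℕ (t p) ℕ.+ ∑ℕ (λ i → t (punchIn p i) p) ℕ.+ ∑ℕ (λ i → ∑ℕ (t′ i))
    ≡⟨ cong₂ (λ a b → ∑ℕ (t p) ℕ.+ a ℕ.+ b) column (sym (inversions-∑ℕ (remove p σ))) ⟩
  ∑ℕ (t p) ℕ.+ ∑ℕ (λ j → t j p) ℕ.+ inversions (remove p σ)
    ≡⟨ cong (ℕ._+ inversions (remove p σ)) (∑ℕ-distrib-+ (t p) (λ j → t j p)) ⟨
  ∑ℕ (λ j → t p j ℕ.+ t j p) ℕ.+ inversions (remove p σ) ∎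
  where
  t : Fin (suc n) → Fin (suc n) → ℕ
  t i j = ⟦ inverted? σ i j ⟧
  t′ : Fin n → Fin n → ℕ
  t′ i j = ⟦ inverted? (remove p σ) i j ⟧
  column : ∑ℕ (λ i → t (punchIn p i) p) ≡ ∑ℕ (λ j → t j p)
  column = sym (trans (∑ℕ-remove {i = p} (λ j → t j p))
    (cong (ℕ._+ ∑ℕ (λ i → t (punchIn p i) p)) (inverted-irrefl σ p)))

-- The contribution of one `j` to `crossings-∑ℕ`: A and A′ are j < p and p < j, B and B′ are σ j < σ
-- p and σ p < σ j, and E, E′ are the equalities. Trichotomy on both sides leaves a finite check,
-- and E ⇔ E′, the injectivity of σ, excludes the mixed cases. Abstract propositions let the
-- decisions be rewritten to their truth values.
crossings : {A A′ B B′ E E′ : Set} (a? : Dec A) (a′? : Dec A′) (b? : Dec B) (b′? : Dec B′) →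
  Tri A E A′ → Tri B E′ B′ → (E → E′) → (E′ → E) →
  let u = ⟦ a? ×-dec b? ⟧ in
  (⟦ a′? ×-dec b? ⟧ ℕ.+ ⟦ a? ×-dec b′? ⟧) ℕ.+ (u ℕ.+ u) ≡ ⟦ a? ⟧ ℕ.+ ⟦ b? ⟧
crossings a? a′? b? b′? (tri< a _ ¬a′) (tri< b _ ¬b′) _ _
  rewrite dec-true a? a | dec-false a′? ¬a′ | dec-true b? b | dec-false b′? ¬b′ = refl
crossings a? a′? b? b′? (tri< a _ ¬a′) (tri> ¬b _ b′) _ _
  rewrite dec-true a? a | dec-false a′? ¬a′ | dec-false b? ¬b | dec-true b′? b′ = refl
crossings a? a′? b? b′? (tri> ¬a _ a′) (tri< b _ ¬b′) _ _
  rewrite dec-false a? ¬a | dec-true a′? a′ | dec-true b? b = refl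
crossings a? a′? b? b′? (tri> ¬a _ a′) (tri> ¬b _ b′) _ _
  rewrite dec-false a? ¬a | dec-true a′? a′ | dec-false b? ¬b = refl
crossings a? a′? b? b′? (tri≈ ¬a _ ¬a′) (tri≈ ¬b _ ¬b′) _ _
  rewrite dec-false a? ¬a | dec-false a′? ¬a′ | dec-false b? ¬b = refl
crossings _ _ _ _ (tri≈ _ e _) (tri< _ ¬e′ _) f _ = contradiction (f e) ¬e′
crossings _ _ _ _ (tri≈ _ e _) (tri> _ ¬e′ _) f _ = contradiction (f e) ¬e′
crossings _ _ _ _ (tri< _ ¬e _) (tri≈ _ e′ _) _ g = contradiction (g e′) ¬e
crossings _ _ _ _ (tri> _ ¬e _) (tri≈ _ e′ _) _ g = contradiction (g e′) ¬e

⟨$⟩ʳ-injective : (σ : Permutation′ n) {i j : Fin n} → σ ⟨$⟩ʳ i ≡ σ ⟨$⟩ʳ j → i ≡ j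
⟨$⟩ʳ-injective σ eq = trans (sym (Perm.inverseˡ σ)) (trans (cong (σ Perm.⟨$⟩ˡ_) eq) (Perm.inverseˡ σ))

-- Adding twice the number of j with j < p and σ j < σ p completes the inversions
-- involving p to the two sets {j < p} and {σ j < σ p}.
crossings-∑ℕ : (p : Fin n) (σ : Permutation′ n) →
  let u = ∑ℕ (λ j → ⟦ (j Fin.<? p) ×-dec ((σ ⟨$⟩ʳ j) Fin.<? (σ ⟨$⟩ʳ p)) ⟧) in
  ∑ℕ (λ j → ⟦ inverted? σ p j ⟧ ℕ.+ ⟦ inverted? σ j p ⟧) ℕ.+ (u ℕ.+ u) ≡ toℕ p ℕ.+ toℕ (σ ⟨$⟩ʳ p)
crossings-∑ℕ {n} p σ = begin
  ∑ℕ t ℕ.+ (∑ℕ u ℕ.+ ∑ℕ u)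
    ≡⟨ cong (∑ℕ t ℕ.+_) (∑ℕ-distrib-+ u u) ⟨
  ∑ℕ t ℕ.+ ∑ℕ (λ j → u j ℕ.+ u j)
    ≡⟨ ∑ℕ-distrib-+ t (λ j → u j ℕ.+ u j) ⟨
  ∑ℕ (λ j → t j ℕ.+ (u j ℕ.+ u j))
    ≡⟨ ∑ℕ-cong (λ j → crossings (j Fin.<? p) (p Fin.<? j)
         ((σ ⟨$⟩ʳ j) Fin.<? (σ ⟨$⟩ʳ p)) ((σ ⟨$⟩ʳ p) Fin.<? (σ ⟨$⟩ʳ j))
         (Fin.<-cmp j p) (Fin.<-cmp (σ ⟨$⟩ʳ j) (σ ⟨$⟩ʳ p)) (cong (σ ⟨$⟩ʳ_)) (⟨$⟩ʳ-injective σ)) ⟩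
  ∑ℕ (λ j → below p j ℕ.+ below (σ ⟨$⟩ʳ p) (σ ⟨$⟩ʳ j))
    ≡⟨ ∑ℕ-distrib-+ (below p) (λ j → below (σ ⟨$⟩ʳ p) (σ ⟨$⟩ʳ j)) ⟩
  ∑ℕ (below p) ℕ.+ ∑ℕ (λ j → below (σ ⟨$⟩ʳ p) (σ ⟨$⟩ʳ j))
    ≡⟨ cong (∑ℕ (below p) ℕ.+_) (∑ℕ-permute (below (σ ⟨$⟩ʳ p)) σ) ⟨
  ∑ℕ (below p) ℕ.+ ∑ℕ (below (σ ⟨$⟩ʳ p))
    ≡⟨ cong₂ ℕ._+_ (∑ℕ-< p) (∑ℕ-< (σ ⟨$⟩ʳ p)) ⟩
  toℕ p ℕ.+ toℕ (σ ⟨$⟩ʳ p) ∎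
  where
  below : Fin n → Fin n → ℕ
  below i j = ⟦ j Fin.<? i ⟧
  t u : Fin n → ℕ
  t j = ⟦ inverted? σ p j ⟧ ℕ.+ ⟦ inverted? σ j p ⟧
  u j = ⟦ (j Fin.<? p) ×-dec ((σ ⟨$⟩ʳ j) Fin.<? (σ ⟨$⟩ʳ p)) ⟧

-1^double : ∀ m → -1ℤ ^ (m ℕ.+ m) ≡ 1ℤ
-1^double zero    = refl
-1^double (suc m) rewrite ℕ.+-suc m m | -1^double m = refl

-1^+double : ∀ l m → -1ℤ ^ (l ℕ.+ (m ℕ.+ m)) ≡ -1ℤ ^ l
-1^+double l m = trans (ℤ.^-distribˡ-+-* -1ℤ l (m ℕ.+ m))
  (trans (cong (-1ℤ ^ l ℤ.*_) (-1^double m)) (ℤ.*-identityʳ _))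

-- Only parity matters: by `crossings-∑ℕ` the number of inversions involving `p` differs from
-- `toℕ p` + `toℕ (σ p)` by the even number 2u. Hence 2u is added to the exponent before the
-- inversions are split.
sign-remove : (p : Fin (suc n)) (σ : Permutation′ (suc n)) →
  sign σ ≡ -1ℤ ^ (toℕ p ℕ.+ toℕ (σ ⟨$⟩ʳ p)) ℤ.* sign (remove p σ)
sign-remove p σ = begin
  -1ℤ ^ inversions σ
    ≡⟨ -1^+double (inversions σ) u ⟨
  -1ℤ ^ (inversions σ ℕ.+ (u ℕ.+ u))
    ≡⟨ cong (λ k → -1ℤ ^ (k ℕ.+ (u ℕ.+ u))) (inversions-remove p σ) ⟩
  -1ℤ ^ (t ℕ.+ inversions (remove p σ) ℕ.+ (u ℕ.+ u))
    ≡⟨ cong (-1ℤ ^_) (solve 3 (λ a b c → a :+ b :+ c := a :+ c :+ b) refl t (inversions (remove p σ)) (u ℕ.+ u)) ⟩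
  -1ℤ ^ (t ℕ.+ (u ℕ.+ u) ℕ.+ inversions (remove p σ))
    ≡⟨ cong (λ k → -1ℤ ^ (k ℕ.+ inversions (remove p σ))) (crossings-∑ℕ p σ) ⟩
  -1ℤ ^ (toℕ p ℕ.+ toℕ (σ ⟨$⟩ʳ p) ℕ.+ inversions (remove p σ))
    ≡⟨ ℤ.^-distribˡ-+-* -1ℤ (toℕ p ℕ.+ toℕ (σ ⟨$⟩ʳ p)) (inversions (remove p σ)) ⟩
  -1ℤ ^ (toℕ p ℕ.+ toℕ (σ ⟨$⟩ʳ p)) ℤ.* sign (remove p σ) ∎
  where
  open ℕSolver.+-*-Solver using (solve; _:=_; _:+_)
  t = ∑ℕ (λ j → ⟦ inverted? σ p j ⟧ ℕ.+ ⟦ inverted? σ j p ⟧)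
  u = ∑ℕ (λ j → ⟦ (j Fin.<? p) ×-dec ((σ ⟨$⟩ʳ j) Fin.<? (σ ⟨$⟩ʳ p)) ⟧)

sign-cong : (σ τ : Permutation′ n) → σ Perm.≈ τ → sign σ ≡ sign τ
sign-cong σ τ σ≈τ = cong (-1ℤ ^_) (begin
  inversions σ                         ≡⟨ inversions-∑ℕ σ ⟩
  ∑ℕ (λ i → ∑ℕ λ j → ⟦ inverted? σ i j ⟧) ≡⟨ ∑ℕ-cong (λ i → ∑ℕ-cong λ j →
    ⟦⟧-cong (inverted? σ i j) (inverted? τ i j)
      (map id (subst₂ Fin._<_ (σ≈τ j) (σ≈τ i)))
      (map id (subst₂ Fin._<_ (sym (σ≈τ j)) (sym (σ≈τ i))))) ⟩
  ∑ℕ (λ i → ∑ℕ λ j → ⟦ inverted? τ i j ⟧) ≡⟨ inversions-∑ℕ τ ⟨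
  inversions τ                         ∎)

-- Multiplicativity of the sign.

remove-∘ₚ : (p : Fin (suc n)) (τ σ : Permutation′ (suc n)) →
  remove p (τ ∘ₚ σ) Perm.≈ remove p τ ∘ₚ remove (τ ⟨$⟩ʳ p) σ
remove-∘ₚ p τ σ i = Fin.punchIn-injective (σ ⟨$⟩ʳ (τ ⟨$⟩ʳ p)) _ _ (begin
  punchIn (σ ⟨$⟩ʳ (τ ⟨$⟩ʳ p)) (remove p (τ ∘ₚ σ) ⟨$⟩ʳ i)
    ≡⟨ Perm.punchIn-permute (τ ∘ₚ σ) p i ⟨
  σ ⟨$⟩ʳ (τ ⟨$⟩ʳ punchIn p i)
    ≡⟨ cong (σ ⟨$⟩ʳ_) (Perm.punchIn-permute τ p i) ⟩
  σ ⟨$⟩ʳ punchIn (τ ⟨$⟩ʳ p) (remove p τ ⟨$⟩ʳ i)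
    ≡⟨ Perm.punchIn-permute σ (τ ⟨$⟩ʳ p) _ ⟩
  punchIn (σ ⟨$⟩ʳ (τ ⟨$⟩ʳ p)) (remove (τ ⟨$⟩ʳ p) σ ⟨$⟩ʳ (remove p τ ⟨$⟩ʳ i)) ∎)

-- Induction on the number of points: follow `zero` to `p` under τ and on to its image under σ, and
-- remove these points. By `remove-∘ₚ` the rest is again a composite, now on one point fewer.
sign-∘ₚ : (τ σ : Permutation′ n) → sign (τ ∘ₚ σ) ≡ sign σ ℤ.* sign τ
sign-∘ₚ {zero}  τ σ = refl
sign-∘ₚ {suc n} τ σ = begin
  sign (τ ∘ₚ σ)
    ≡⟨ sign-remove zero (τ ∘ₚ σ) ⟩
  -1ℤ ^ l ℤ.* sign (remove zero (τ ∘ₚ σ))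
    ≡⟨ cong (-1ℤ ^ l ℤ.*_) (trans
         (sign-cong (remove zero (τ ∘ₚ σ)) (remove zero τ ∘ₚ remove p σ) (remove-∘ₚ zero τ σ))
         (sign-∘ₚ (remove zero τ) (remove p σ))) ⟩
  -1ℤ ^ l ℤ.* (sign (remove p σ) ℤ.* sign (remove zero τ))
    -- The direct route from `zero` has exponent `l`; the route through `p` has exponents `p` and
    -- `p + l`. They differ by the even number 2p.
    ≡⟨ cong (ℤ._* (sign (remove p σ) ℤ.* sign (remove zero τ)))
         (trans (sym (-1^+double l (toℕ p)))
         (trans (cong (-1ℤ ^_) (N.solve 2 (λ a b → a N.:+ (b N.:+ b) N.:= b N.:+ a N.:+ b) refl l (toℕ p)))
                (ℤ.^-distribˡ-+-* -1ℤ (toℕ p ℕ.+ l) (toℕ p)))) ⟩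
  -1ℤ ^ (toℕ p ℕ.+ l) ℤ.* -1ℤ ^ toℕ p ℤ.* (sign (remove p σ) ℤ.* sign (remove zero τ))
    ≡⟨ Z.solve 4 (λ a b c d → a Z.:* b Z.:* (c Z.:* d) Z.:= (a Z.:* c) Z.:* (b Z.:* d)) refl
         (-1ℤ ^ (toℕ p ℕ.+ l)) (-1ℤ ^ toℕ p) (sign (remove p σ)) (sign (remove zero τ)) ⟩
  (-1ℤ ^ (toℕ p ℕ.+ l) ℤ.* sign (remove p σ)) ℤ.* (-1ℤ ^ toℕ p ℤ.* sign (remove zero τ))
    ≡⟨ cong₂ ℤ._*_ (sign-remove p σ) (sign-remove zero τ) ⟨
  sign σ ℤ.* sign τ ∎
  where
  module N = ℕSolver.+-*-Solver
  module Z = ℤSolver.+-*-Solver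
  p = τ ⟨$⟩ʳ zero
  l = toℕ (σ ⟨$⟩ʳ p)

-- Insertion into single permutations and into tuples.

insert-at : (p j : Fin (suc n)) (ρ : Permutation′ n) → insert p j ρ ⟨$⟩ʳ p ≡ j
insert-at p j ρ with p Fin.≟ p
... | yes _  = refl
... | no p≢p = contradiction refl p≢p

insert-cong : (p j : Fin (suc n)) {π ρ : Permutation′ n} →
  π Perm.≈ ρ → insert p j π Perm.≈ insert p j ρ
insert-cong p j π≈ρ k with p Fin.≟ k
... | yes _  = refl
... | no p≢k = cong (punchIn j) (π≈ρ (Fin.punchOut p≢k))

sign-insert : (p j : Fin (suc n)) (ρ : Permutation′ n) →
  sign (insert p j ρ) ≡ -1ℤ ^ (toℕ p ℕ.+ toℕ j) ℤ.* sign ρ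
sign-insert p j ρ = trans (sign-remove p (insert p j ρ))
  (cong₂ (λ k s → -1ℤ ^ (toℕ p ℕ.+ toℕ k) ℤ.* s) (insert-at p j ρ)
    (sign-cong (remove p (insert p j ρ)) ρ (Perm.remove-insert p j ρ)))

sign-compose-insert : (p : Fin (suc n)) (I : Vec (Fin (suc n)) d) (ρs : Vec (Permutation′ n) d) →
  sign (compose (Vec.zipWith (insert p) I ρs)) ≡
  -1ℤ ^ (d * suc (toℕ p) ℕ.+ indexSum I) ℤ.* sign (compose ρs)
sign-compose-insert {n = n} p [] [] = begin
  sign (Perm.id {n = suc n})                             ≡⟨ sign-remove p Perm.id ⟩
  -- The empty composite on `suc n` points has to become the one on `n` points; removing the fixed
  -- point `p` has the even exponent 2p.
  -1ℤ ^ (toℕ p ℕ.+ toℕ p) ℤ.* sign (remove p Perm.id)    ≡⟨ cong₂ ℤ._*_ (-1^double (toℕ p))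
                                                              (sign-cong (remove p Perm.id) Perm.id remove-id) ⟩
  1ℤ ℤ.* sign (Perm.id {n = n})                          ∎
  where
  remove-id : remove p Perm.id Perm.≈ Perm.id
  remove-id i = Fin.punchIn-injective p _ _ (sym (Perm.punchIn-permute Perm.id p i))
sign-compose-insert {d = suc d} p (i ∷ I) (ρ ∷ ρs) = begin
  sign (compose (Vec.zipWith (insert p) I ρs) ∘ₚ insert p i ρ)
    ≡⟨ sign-∘ₚ (compose (Vec.zipWith (insert p) I ρs)) (insert p i ρ) ⟩
  sign (insert p i ρ) ℤ.* sign (compose (Vec.zipWith (insert p) I ρs))
    ≡⟨ cong₂ ℤ._*_ (sign-insert p i ρ) (sign-compose-insert p I ρs) ⟩
  -1ℤ ^ a ℤ.* sign ρ ℤ.* (-1ℤ ^ b ℤ.* sign (compose ρs))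
    ≡⟨ Z.solve 4 (λ w x y z → w Z.:* x Z.:* (y Z.:* z) Z.:= (w Z.:* y) Z.:* (x Z.:* z)) refl
         (-1ℤ ^ a) (sign ρ) (-1ℤ ^ b) (sign (compose ρs)) ⟩
  -1ℤ ^ a ℤ.* -1ℤ ^ b ℤ.* (sign ρ ℤ.* sign (compose ρs))
    ≡⟨ cong₂ ℤ._*_ (ℤ.^-distribˡ-+-* -1ℤ a b) (sign-∘ₚ (compose ρs) ρ) ⟨
  -1ℤ ^ (a ℕ.+ b) ℤ.* sign (compose (ρ ∷ ρs))
    -- `sign-insert` counts `p` and `i` from 0, whereas the claim counts both from 1; the extra 2 in
    -- the exponent does not change the sign.
    ≡⟨ cong (ℤ._* sign (compose (ρ ∷ ρs))) (-1^+double (a ℕ.+ b) 1) ⟨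
  -1ℤ ^ (a ℕ.+ b ℕ.+ 2) ℤ.* sign (compose (ρ ∷ ρs))
    ≡⟨ cong (λ k → -1ℤ ^ k ℤ.* sign (compose (ρ ∷ ρs)))
         (N.solve 4 (λ p i e s → p N.:+ i N.:+ (e N.:+ s) N.:+ N.con 2
                         N.:= (N.con 1 N.:+ p N.:+ e) N.:+ (N.con 1 N.:+ i N.:+ s))
            refl (toℕ p) (toℕ i) (d * suc (toℕ p)) (indexSum I)) ⟩
  -1ℤ ^ (suc d * suc (toℕ p) ℕ.+ indexSum (i ∷ I)) ℤ.* sign (compose (ρ ∷ ρs)) ∎
  where
  module N = ℕSolver.+-*-Solver
  module Z = ℤSolver.+-*-Solver
  a = toℕ p ℕ.+ toℕ i
  b = d * suc (toℕ p) ℕ.+ indexSum I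

sign-compose-insert-even : ∀ k (p : Fin (suc n))
  (I : Vec (Fin (suc n)) (2 * k)) (ρs : Vec (Permutation′ n) (2 * k)) →
  sign (compose (Vec.zipWith (insert p) I ρs)) ≡ -1ℤ ^ indexSum I ℤ.* sign (compose ρs)
sign-compose-insert-even k p I ρs = trans (sign-compose-insert p I ρs)
  (cong (ℤ._* sign (compose ρs)) (trans
    (cong (-1ℤ ^_) (solve 3 (λ k p s → con 2 :* k :* p :+ s := s :+ (k :* p :+ k :* p)) refl
      k (suc (toℕ p)) (indexSum I)))
    (-1^+double (indexSum I) (k * suc (toℕ p)))))
  where open ℕSolver.+-*-Solver using (solve; _:=_; _:+_; _:*_; con)

compose-cong : {σs τs : Vec (Permutation′ n) d} → Pointwise Perm._≈_ σs τs → compose σs Perm.≈ compose τs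
compose-cong []                         i = refl
compose-cong (_∷_ {x = σ} σ≈τ σs≈τs) i = trans (cong (σ ⟨$⟩ʳ_) (compose-cong σs≈τs i)) (σ≈τ _)

map-⟨$⟩ʳ-cong : {σs τs : Vec (Permutation′ n) d} → Pointwise Perm._≈_ σs τs →
  ∀ i → Vec.map (_⟨$⟩ʳ i) σs ≡ Vec.map (_⟨$⟩ʳ i) τs
map-⟨$⟩ʳ-cong []            i = refl
map-⟨$⟩ʳ-cong (σ≈τ ∷ σs≈τs) i = cong₂ _∷_ (σ≈τ i) (map-⟨$⟩ʳ-cong σs≈τs i)

map-insert-at : (p : Fin (suc n)) (I : Vec (Fin (suc n)) d) (ρs : Vec (Permutation′ n) d) →
  Vec.map (_⟨$⟩ʳ p) (Vec.zipWith (insert p) I ρs) ≡ I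
map-insert-at p []      []       = refl
map-insert-at p (i ∷ I) (ρ ∷ ρs) = cong₂ _∷_ (insert-at p i ρ) (map-insert-at p I ρs)

map-insert-punchIn : (p : Fin (suc n)) (I : Vec (Fin (suc n)) d) (ρs : Vec (Permutation′ n) d) →
  ∀ k → Vec.map (_⟨$⟩ʳ punchIn p k) (Vec.zipWith (insert p) I ρs) ≡
        Vec.zipWith punchIn I (Vec.map (_⟨$⟩ʳ k) ρs)
map-insert-punchIn p []      []       k = refl
map-insert-punchIn p (i ∷ I) (ρ ∷ ρs) k = cong₂ _∷_ (Perm.insert-punchIn p i ρ k) (map-insert-punchIn p I ρs k)

-- Finite rational sums and indicators.

𝟙 : {P : Set} → Dec P → ℚ
𝟙 p? = if does p? then 1ℚ else 0ℚ

𝟙-cong : {P Q : Set} (p? : Dec P) (q? : Dec Q) → (P → Q) → (Q → P) → 𝟙 p? ≡ 𝟙 q?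
𝟙-cong p? q? f g = cong (if_then 1ℚ else 0ℚ) (does-⇔ (mk⇔ f g) p? q?)

𝟙-× : {P Q : Set} (p? : Dec P) (q? : Dec Q) → 𝟙 (p? ×-dec q?) ≡ 𝟙 p? ℚ.* 𝟙 q?
𝟙-× p? q? with does p?
... | true  = sym (ℚ.*-identityˡ (𝟙 q?))
... | false = sym (ℚ.*-zeroˡ (𝟙 q?))

∑-cong : (xs : List A) {f g : A → ℚ} → (∀ x → f x ≡ g x) → ∑ xs f ≡ ∑ xs g
∑-cong []       f≗g = refl
∑-cong (x ∷ xs) f≗g = cong₂ ℚ._+_ (f≗g x) (∑-cong xs f≗g)

∑-0 : (xs : List A) → ∑ xs (λ _ → 0ℚ) ≡ 0ℚ
∑-0 []       = refl
∑-0 (x ∷ xs) = trans (ℚ.+-identityˡ _) (∑-0 xs)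

∑-distrib-+ : (xs : List A) (f g : A → ℚ) → ∑ xs (λ x → f x ℚ.+ g x) ≡ ∑ xs f ℚ.+ ∑ xs g
∑-distrib-+ []       f g = refl
∑-distrib-+ (x ∷ xs) f g = trans (cong (f x ℚ.+ g x ℚ.+_) (∑-distrib-+ xs f g))
  (solve 4 (λ a b c d → a :+ b :+ (c :+ d) := a :+ c :+ (b :+ d)) refl (f x) (g x) (∑ xs f) (∑ xs g))
  where open ℚSolver.+-*-Solver using (solve; _:=_; _:+_)

*-distribˡ-∑ : (c : ℚ) (xs : List A) (f : A → ℚ) → c ℚ.* ∑ xs f ≡ ∑ xs (λ x → c ℚ.* f x)
*-distribˡ-∑ c []       f = ℚ.*-zeroʳ c
*-distribˡ-∑ c (x ∷ xs) f = trans (ℚ.*-distribˡ-+ c (f x) (∑ xs f)) (cong (c ℚ.* f x ℚ.+_) (*-distribˡ-∑ c xs f))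

*-distribʳ-∑ : (c : ℚ) (xs : List A) (f : A → ℚ) → ∑ xs f ℚ.* c ≡ ∑ xs (λ x → f x ℚ.* c)
*-distribʳ-∑ c xs f = trans (ℚ.*-comm (∑ xs f) c)
  (trans (*-distribˡ-∑ c xs f) (∑-cong xs λ x → ℚ.*-comm c (f x)))

∑-swap : (xs : List A) (ys : List B) (f : A → B → ℚ) →
  ∑ xs (λ x → ∑ ys (f x)) ≡ ∑ ys (λ y → ∑ xs λ x → f x y)
∑-swap []       ys f = sym (∑-0 ys)
∑-swap (x ∷ xs) ys f = trans (cong (∑ ys (f x) ℚ.+_) (∑-swap xs ys f)) (sym (∑-distrib-+ ys (f x) _))

∑-++ : (xs ys : List A) (f : A → ℚ) → ∑ (xs List.++ ys) f ≡ ∑ xs f ℚ.+ ∑ ys f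
∑-++ []       ys f = sym (ℚ.+-identityˡ _)
∑-++ (x ∷ xs) ys f = trans (cong (f x ℚ.+_) (∑-++ xs ys f)) (sym (ℚ.+-assoc (f x) _ _))

∑-map : (g : A → B) (xs : List A) (f : B → ℚ) → ∑ (List.map g xs) f ≡ ∑ xs (f ∘ g)
∑-map g []       f = refl
∑-map g (x ∷ xs) f = cong (f (g x) ℚ.+_) (∑-map g xs f)

∑-product : (h : A → B → C) (xs : List A) (ys : List B) (f : C → ℚ) →
  ∑ (List.cartesianProductWith h xs ys) f ≡ ∑ xs (λ x → ∑ ys λ y → f (h x y))
∑-product h []       ys f = refl
∑-product h (x ∷ xs) ys f = trans (∑-++ (List.map (h x) ys) _ f)
  (cong₂ ℚ._+_ (∑-map (h x) ys f) (∑-product h xs ys f))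

∑-filter : {P : A → Set} (P? : Decidable P) (xs : List A) (f : A → ℚ) →
  ∑ (List.filter P? xs) f ≡ ∑ xs (λ x → 𝟙 (P? x) ℚ.* f x)
∑-filter P? []       f = refl
∑-filter P? (x ∷ xs) f with does (P? x)
... | true  = cong₂ ℚ._+_ (sym (ℚ.*-identityˡ (f x))) (∑-filter P? xs f)
... | false = trans (∑-filter P? xs f) (sym (trans (cong (ℚ._+ ∑ xs _) (ℚ.*-zeroˡ (f x))) (ℚ.+-identityˡ _)))

∑-allFin-suc : (f : Fin (suc n) → ℚ) → ∑ (List.allFin (suc n)) f ≡ f zero ℚ.+ ∑ (List.allFin n) (f ∘ suc)
∑-allFin-suc f = cong (f zero ℚ.+_) (trans
  (cong (λ xs → ∑ xs f) (sym (List.map-tabulate id suc))) (∑-map suc (List.allFin _) f))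

∑-allFin-𝟙 : (i : Fin n) → ∑ (List.allFin n) (λ j → 𝟙 (j Fin.≟ i)) ≡ 1ℚ
∑-allFin-𝟙 {suc n} zero = trans (∑-allFin-suc {n} (λ j → 𝟙 (j Fin.≟ zero)))
  (cong (1ℚ ℚ.+_) (∑-0 (List.allFin n)))
∑-allFin-𝟙 {suc n} (suc i) = trans (∑-allFin-suc {n} (λ j → 𝟙 (j Fin.≟ suc i)))
  (trans (ℚ.+-identityˡ _) (∑-allFin-𝟙 i))

-- `_/_` divides by a gcd, so identities between quotients with variable numerators do not compute.
-- They are obtained from unnormalised fractions, of which `i / 1` is the image of `mkℚᵘ i 0` by
-- definition.
fromℚᵘ-homo-* : ∀ p q → ℚ.fromℚᵘ p ℚ.* ℚ.fromℚᵘ q ≡ ℚ.fromℚᵘ (p ℚᵘ.* q)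
fromℚᵘ-homo-* p q = begin
  ℚ.fromℚᵘ p ℚ.* ℚ.fromℚᵘ q
    ≡⟨ ℚ.fromℚᵘ-toℚᵘ _ ⟨
  ℚ.fromℚᵘ (ℚ.toℚᵘ (ℚ.fromℚᵘ p ℚ.* ℚ.fromℚᵘ q))
    ≡⟨ ℚ.fromℚᵘ-cong (ℚᵘ.≃-trans (ℚ.toℚᵘ-homo-* (ℚ.fromℚᵘ p) (ℚ.fromℚᵘ q))
         (ℚᵘ.*-cong (ℚ.toℚᵘ-fromℚᵘ p) (ℚ.toℚᵘ-fromℚᵘ q))) ⟩
  ℚ.fromℚᵘ (p ℚᵘ.* q) ∎

fromℚᵘ-homo-+ : ∀ p q → ℚ.fromℚᵘ p ℚ.+ ℚ.fromℚᵘ q ≡ ℚ.fromℚᵘ (p ℚᵘ.+ q)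
fromℚᵘ-homo-+ p q = begin
  ℚ.fromℚᵘ p ℚ.+ ℚ.fromℚᵘ q
    ≡⟨ ℚ.fromℚᵘ-toℚᵘ _ ⟨
  ℚ.fromℚᵘ (ℚ.toℚᵘ (ℚ.fromℚᵘ p ℚ.+ ℚ.fromℚᵘ q))
    ≡⟨ ℚ.fromℚᵘ-cong (ℚᵘ.≃-trans (ℚ.toℚᵘ-homo-+ (ℚ.fromℚᵘ p) (ℚ.fromℚᵘ q))
         (ℚᵘ.+-cong (ℚ.toℚᵘ-fromℚᵘ p) (ℚ.toℚᵘ-fromℚᵘ q))) ⟩
  ℚ.fromℚᵘ (p ℚᵘ.+ q) ∎

/1-homo-* : ∀ i j → (i ℤ.* j) / 1 ≡ (i / 1) ℚ.* (j / 1)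
/1-homo-* i j = sym (fromℚᵘ-homo-* (mkℚᵘ i 0) (mkℚᵘ j 0))

suc/1 : ∀ n → + suc n / 1 ≡ 1ℚ ℚ.+ (+ n / 1)
suc/1 n = sym (trans (fromℚᵘ-homo-+ (mkℚᵘ 1ℤ 0) (mkℚᵘ (+ n) 0))
  (cong (λ i → (1ℤ ℤ.+ i) / 1) (ℤ.*-identityʳ (+ n))))

1/[m*n]*m : ∀ m n .{{_ : ℕ.NonZero n}} .{{_ : ℕ.NonZero (suc m * n)}} →
  (1ℤ / (suc m * n)) ℚ.* (+ suc m / 1) ≡ 1ℤ / n
1/[m*n]*m m (suc n) = trans (fromℚᵘ-homo-* (mkℚᵘ 1ℤ (n ℕ.+ m * suc n)) (mkℚᵘ (+ suc m) 0))
  (ℚ.fromℚᵘ-cong {x = mkℚᵘ 1ℤ (n ℕ.+ m * suc n) ℚᵘ.* mkℚᵘ (+ suc m) 0} {y = mkℚᵘ 1ℤ n} (*≡* (begin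
    1ℤ ℤ.* + suc m ℤ.* + suc n         ≡⟨ cong (ℤ._* + suc n) (ℤ.*-identityˡ (+ suc m)) ⟩
    + suc m ℤ.* + suc n                ≡⟨ ℤ.pos-* (suc m) (suc n) ⟨
    + (suc m * suc n)                  ≡⟨ cong +_ (ℕ.*-identityʳ (suc m * suc n)) ⟨
    + (suc m * suc n * 1)              ≡⟨ ℤ.*-identityˡ _ ⟨
    1ℤ ℤ.* + (suc m * suc n * 1)       ∎)))

∑-allFin-const : ∀ n (c : ℚ) → ∑ (List.allFin n) (λ _ → c) ≡ (+ n / 1) ℚ.* c
∑-allFin-const zero    c = sym (ℚ.*-zeroˡ c)
∑-allFin-const (suc n) c = begin
  ∑ (List.allFin (suc n)) (λ _ → c)     ≡⟨ ∑-allFin-suc {n} (λ _ → c) ⟩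
  c ℚ.+ ∑ (List.allFin n) (λ _ → c)     ≡⟨ cong (c ℚ.+_) (∑-allFin-const n c) ⟩
  c ℚ.+ (+ n / 1) ℚ.* c                 ≡⟨ cong (ℚ._+ (+ n / 1) ℚ.* c) (ℚ.*-identityˡ c) ⟨
  1ℚ ℚ.* c ℚ.+ (+ n / 1) ℚ.* c          ≡⟨ ℚ.*-distribʳ-+ c 1ℚ (+ n / 1) ⟨
  (1ℚ ℚ.+ (+ n / 1)) ℚ.* c              ≡⟨ cong (ℚ._* c) (suc/1 n) ⟨
  (+ suc n / 1) ℚ.* c                   ∎

-- Sums over tuples, and replacing one list by an equivalent one.

∑-tuples-product : (h : A → B → C) (xs : List A) (ys : List B) (d : ℕ) (f : Vec C d → ℚ) →
  ∑ (tuples (List.cartesianProductWith h xs ys) d) f ≡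
  ∑ (tuples xs d) (λ I → ∑ (tuples ys d) λ ρs → f (Vec.zipWith h I ρs))
∑-tuples-product h xs ys zero    f = cong (ℚ._+ 0ℚ) (sym (ℚ.+-identityʳ (f [])))
∑-tuples-product h xs ys (suc d) f = begin
  ∑ (tuples zs (suc d)) f
    ≡⟨ ∑-product _∷_ zs (tuples zs d) f ⟩
  ∑ zs (λ z → ∑ (tuples zs d) λ σs → f (z ∷ σs))
    ≡⟨ ∑-product h xs ys _ ⟩
  ∑ xs (λ x → ∑ ys λ y → ∑ (tuples zs d) λ σs → f (h x y ∷ σs))
    ≡⟨ ∑-cong xs (λ x → ∑-cong ys λ y → ∑-tuples-product h xs ys d (f ∘ (h x y ∷_))) ⟩
  ∑ xs (λ x → ∑ ys λ y → ∑ (tuples xs d) λ I → ∑ (tuples ys d) λ ρs → f (h x y ∷ Vec.zipWith h I ρs))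
    -- Moving the sum over `y` past the one over `I` puts `x` next to `I` and `y` next to `ρs`, so
    -- that each pair forms one longer tuple.
    ≡⟨ ∑-cong xs (λ x → ∑-swap ys (tuples xs d) _) ⟩
  ∑ xs (λ x → ∑ (tuples xs d) λ I → ∑ ys λ y → ∑ (tuples ys d) λ ρs → f (h x y ∷ Vec.zipWith h I ρs))
    ≡⟨ ∑-cong xs (λ x → ∑-cong (tuples xs d) λ I → ∑-product _∷_ ys (tuples ys d) _) ⟨
  ∑ xs (λ x → ∑ (tuples xs d) λ I → ∑ (tuples ys (suc d)) λ ρs → f (Vec.zipWith h (x ∷ I) ρs))
    ≡⟨ ∑-product _∷_ xs (tuples xs d) _ ⟨
  ∑ (tuples xs (suc d)) (λ I → ∑ (tuples ys (suc d)) λ ρs → f (Vec.zipWith h I ρs)) ∎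
  where zs = List.cartesianProductWith h xs ys

module _ {_∼_ : A → A → Set} (xs ys : List A) where

  -- Double counting over `xs` and `ys` with weight 𝟙 of x ∼ y: each element has exactly one
  -- partner, counted with multiplicity, in the other list, and `f` agrees on partners, so the
  -- double sum collapses to either side. Neither the order of the lists nor the choice of
  -- representatives enters.
  ∑-reindex : (_∼?_ : ∀ x y → Dec (x ∼ y)) → (∀ {x y} → x ∼ y → y ∼ x) →
    (∀ y → ∑ xs (λ x → 𝟙 (x ∼? y)) ≡ 1ℚ) → (∀ x → ∑ ys (λ y → 𝟙 (y ∼? x)) ≡ 1ℚ) →
    (f : A → ℚ) → (∀ {x y} → x ∼ y → f x ≡ f y) → ∑ xs f ≡ ∑ ys f
  ∑-reindex _∼?_ ∼-sym xs-once ys-once f f-resp = begin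
    ∑ xs f
      ≡⟨ ∑-cong xs (λ x → once ys (λ y → 𝟙 (y ∼? x)) (ys-once x) (f x)) ⟩
    ∑ xs (λ x → ∑ ys λ y → 𝟙 (y ∼? x) ℚ.* f x)
      ≡⟨ ∑-cong xs (λ x → ∑-cong ys (transfer x)) ⟩
    ∑ xs (λ x → ∑ ys λ y → 𝟙 (x ∼? y) ℚ.* f y)
      ≡⟨ ∑-swap xs ys _ ⟩
    ∑ ys (λ y → ∑ xs λ x → 𝟙 (x ∼? y) ℚ.* f y)
      ≡⟨ ∑-cong ys (λ y → once xs (λ x → 𝟙 (x ∼? y)) (xs-once y) (f y)) ⟨
    ∑ ys f ∎
    where
    once : (zs : List A) (g : A → ℚ) → ∑ zs g ≡ 1ℚ → ∀ c → c ≡ ∑ zs (λ z → g z ℚ.* c)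
    once zs g eq c = begin
      c                          ≡⟨ ℚ.*-identityˡ c ⟨
      1ℚ ℚ.* c                   ≡⟨ cong (ℚ._* c) eq ⟨
      ∑ zs g ℚ.* c               ≡⟨ *-distribʳ-∑ c zs g ⟩
      ∑ zs (λ z → g z ℚ.* c)     ∎
    transfer : ∀ x y → 𝟙 (y ∼? x) ℚ.* f x ≡ 𝟙 (x ∼? y) ℚ.* f y
    transfer x y with x ∼? y | y ∼? x
    ... | yes x∼y | yes _   = cong (1ℚ ℚ.*_) (f-resp x∼y)
    ... | no _    | no _    = trans (ℚ.*-zeroˡ (f x)) (sym (ℚ.*-zeroˡ (f y)))
    ... | yes x∼y | no ¬y∼x = contradiction (∼-sym x∼y) ¬y∼x
    ... | no ¬x∼y | yes y∼x = contradiction (∼-sym y∼x) ¬x∼y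

  -- One coordinate at a time: with the head fixed the tails are exchanged by induction, then the
  -- head by `reindex`. Reflexivity keeps the untouched part related to itself.
  ∑-tuples-reindex : (∀ {x} → x ∼ x) →
    ((f : A → ℚ) → (∀ {x y} → x ∼ y → f x ≡ f y) → ∑ xs f ≡ ∑ ys f) →
    ∀ d (f : Vec A d → ℚ) → (∀ {u v} → Pointwise _∼_ u v → f u ≡ f v) →
    ∑ (tuples xs d) f ≡ ∑ (tuples ys d) f
  ∑-tuples-reindex ∼-refl reindex zero    f f-resp = refl
  ∑-tuples-reindex ∼-refl reindex (suc d) f f-resp = begin
    ∑ (tuples xs (suc d)) f
      ≡⟨ ∑-product _∷_ xs (tuples xs d) f ⟩
    ∑ xs (λ x → ∑ (tuples xs d) λ u → f (x ∷ u))
      ≡⟨ ∑-cong xs (λ x → ∑-tuples-reindex ∼-refl reindex d (f ∘ (x ∷_)) (f-resp ∘ (∼-refl ∷_))) ⟩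
    ∑ xs (λ x → ∑ (tuples ys d) λ u → f (x ∷ u))
      ≡⟨ reindex _ (λ x∼y → ∑-cong (tuples ys d) λ u → f-resp (x∼y ∷ Pointwise.refl ∼-refl)) ⟩
    ∑ ys (λ x → ∑ (tuples ys d) λ u → f (x ∷ u))
      ≡⟨ ∑-product _∷_ ys (tuples ys d) f ⟨
    ∑ (tuples ys (suc d)) f ∎

-- The symmetric group enumerated by insertion at any position.

_≈?_ : (π ρ : Permutation′ n) → Dec (π Perm.≈ ρ)
π ≈? ρ = Fin.all? λ i → (π ⟨$⟩ʳ i) Fin.≟ (ρ ⟨$⟩ʳ i)

insertions : Fin (suc n) → List (Permutation′ (suc n))
insertions {n} p = List.cartesianProductWith (insert p) (List.allFin (suc n)) (permutations n)

insert-≈⇒ : (p j : Fin (suc n)) (ρ : Permutation′ n) (π : Permutation′ (suc n)) →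
  insert p j ρ Perm.≈ π → j ≡ π ⟨$⟩ʳ p × ρ Perm.≈ remove p π
insert-≈⇒ p j ρ π eq = j≡πp , λ k → Fin.punchIn-injective j _ _ (begin
  punchIn j (ρ ⟨$⟩ʳ k)                        ≡⟨ Perm.insert-punchIn p j ρ k ⟨
  insert p j ρ ⟨$⟩ʳ punchIn p k               ≡⟨ eq (punchIn p k) ⟩
  π ⟨$⟩ʳ punchIn p k                          ≡⟨ Perm.punchIn-permute π p k ⟩
  punchIn (π ⟨$⟩ʳ p) (remove p π ⟨$⟩ʳ k)      ≡⟨ cong (λ i → punchIn i (remove p π ⟨$⟩ʳ k)) j≡πp ⟨
  punchIn j (remove p π ⟨$⟩ʳ k)               ∎)
  where j≡πp = trans (sym (insert-at p j ρ)) (eq p)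

insert-≈⇐ : (p j : Fin (suc n)) (ρ : Permutation′ n) (π : Permutation′ (suc n)) →
  j ≡ π ⟨$⟩ʳ p × ρ Perm.≈ remove p π → insert p j ρ Perm.≈ π
insert-≈⇐ p _ ρ π (refl , ρ≈) k =
  trans (insert-cong p (π ⟨$⟩ʳ p) {ρ} {remove p π} ρ≈ k) (Perm.insert-remove p π k)

-- Mutual recursion with `insertions-once`: `permutations (suc n)` is `insertions zero` by
-- definition, and an insertion at `p` is determined by the value at `p` and the permutation left
-- after removing `p`. The indicator thus factors into one for each, and the second is summed over
-- `permutations n`.
permutations-once : ∀ n (π : Permutation′ n) → ∑ (permutations n) (λ ρ → 𝟙 (ρ ≈? π)) ≡ 1ℚ
insertions-once : (p : Fin (suc n)) (π : Permutation′ (suc n)) → ∑ (insertions p) (λ ρ → 𝟙 (ρ ≈? π)) ≡ 1ℚ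

permutations-once zero    π = refl
permutations-once (suc n) π = insertions-once zero π

insertions-once {n} p π = begin
  ∑ (insertions p) (λ ρ → 𝟙 (ρ ≈? π))
    ≡⟨ ∑-product (insert p) (List.allFin (suc n)) (permutations n) _ ⟩
  ∑ (List.allFin (suc n)) (λ j → ∑ (permutations n) λ ρ → 𝟙 (insert p j ρ ≈? π))
    ≡⟨ ∑-cong (List.allFin (suc n)) (λ j → ∑-cong (permutations n) λ ρ → trans
         (𝟙-cong (insert p j ρ ≈? π) ((j Fin.≟ (π ⟨$⟩ʳ p)) ×-dec (ρ ≈? remove p π))
           (insert-≈⇒ p j ρ π) (insert-≈⇐ p j ρ π))
         (𝟙-× (j Fin.≟ (π ⟨$⟩ʳ p)) (ρ ≈? remove p π))) ⟩
  ∑ (List.allFin (suc n)) (λ j → ∑ (permutations n) λ ρ → 𝟙 (j Fin.≟ (π ⟨$⟩ʳ p)) ℚ.* 𝟙 (ρ ≈? remove p π))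
    ≡⟨ ∑-cong (List.allFin (suc n)) (λ j → *-distribˡ-∑ (𝟙 (j Fin.≟ (π ⟨$⟩ʳ p))) (permutations n) _) ⟨
  ∑ (List.allFin (suc n)) (λ j → 𝟙 (j Fin.≟ (π ⟨$⟩ʳ p)) ℚ.* ∑ (permutations n) λ ρ → 𝟙 (ρ ≈? remove p π))
    ≡⟨ ∑-cong (List.allFin (suc n)) (λ j → trans
         (cong (𝟙 (j Fin.≟ (π ⟨$⟩ʳ p)) ℚ.*_) (permutations-once n (remove p π))) (ℚ.*-identityʳ (𝟙 (j Fin.≟ (π ⟨$⟩ʳ p))))) ⟩
  ∑ (List.allFin (suc n)) (λ j → 𝟙 (j Fin.≟ (π ⟨$⟩ʳ p)))
    ≡⟨ ∑-allFin-𝟙 (π ⟨$⟩ʳ p) ⟩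
  1ℚ ∎

∑-permutations-insert : (p : Fin (suc n)) (d : ℕ) (f : Vec (Permutation′ (suc n)) d → ℚ) →
  (∀ {σs τs} → Pointwise Perm._≈_ σs τs → f σs ≡ f τs) →
  ∑ (tuples (permutations (suc n)) d) f ≡
  ∑ (tuples (List.allFin (suc n)) d) (λ I → ∑ (tuples (permutations n) d) λ ρs →
    f (Vec.zipWith (insert p) I ρs))
∑-permutations-insert {n} p d f f-resp = trans
  (∑-tuples-reindex (permutations (suc n)) (insertions p) (λ _ → refl)
    (∑-reindex (permutations (suc n)) (insertions p) _≈?_ (λ eq i → sym (eq i))
      (permutations-once (suc n)) (insertions-once p)) d f f-resp)
  (∑-tuples-product (insert p) (List.allFin (suc n)) (permutations n) d f)

-- Laplace expansion of `Det` along the first index.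

detTerm : Tensor d n → Vec (Permutation′ n) d → ℚ
detTerm M σs = (sign (compose σs) / 1) ℚ.* ∏ λ i → M (Vec.map (_⟨$⟩ʳ i) σs)

detTerm-resp : (M : Tensor d n) {σs τs : Vec (Permutation′ n) d} →
  Pointwise Perm._≈_ σs τs → detTerm M σs ≡ detTerm M τs
detTerm-resp M {σs} {τs} σs≈τs = cong₂ (λ s q → (s / 1) ℚ.* q)
  (sign-cong (compose σs) (compose τs) (compose-cong σs≈τs))
  (∏-cong λ i → cong M (map-⟨$⟩ʳ-cong σs≈τs i))

Det-cong : {M N : Tensor d n} → (∀ I → M I ≡ N I) → Det M ≡ Det N
Det-cong {d} {n} M≗N = cong (((1ℤ / (n !)) {{n ℕ.!≢0}}) ℚ.*_)
  (∑-cong (tuples (permutations n) d) λ σs →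
    cong ((sign (compose σs) / 1) ℚ.*_) (∏-cong λ i → M≗N (Vec.map (_⟨$⟩ʳ i) σs)))

minor : Tensor d (suc n) → Vec (Fin (suc n)) d → Tensor d n
minor M I J = M (Vec.zipWith punchIn I J)

-- The product splits at `p`, where the entry is `M I`. Every other position is some `punchIn p k`;
-- there the inserted permutations take the values `punchIn iⱼ (ρⱼ k)`, which index the minor.
detTerm-insert : ∀ k (M : Tensor (2 * k) (suc n)) (p : Fin (suc n)) I ρs →
  detTerm M (Vec.zipWith (insert p) I ρs) ≡
  (-1ℤ ^ indexSum I / 1) ℚ.* (M I ℚ.* detTerm (minor M I) ρs)
detTerm-insert k M p I ρs = begin
  (sign (compose σs) / 1) ℚ.* ∏ (λ i → M (Vec.map (_⟨$⟩ʳ i) σs))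
    ≡⟨ cong₂ ℚ._*_
         (trans (cong (_/ 1) (sign-compose-insert-even k p I ρs)) (/1-homo-* (-1ℤ ^ indexSum I) _))
         (trans (∏-remove {i = p} (λ i → M (Vec.map (_⟨$⟩ʳ i) σs)))
           (cong₂ ℚ._*_ (cong M (map-insert-at p I ρs)) (∏-cong λ i → cong M (map-insert-punchIn p I ρs i)))) ⟩
  ε ℚ.* s ℚ.* (M I ℚ.* π)
    ≡⟨ solve 4 (λ a b c d → a :* b :* (c :* d) := a :* (c :* (b :* d))) refl ε s (M I) π ⟩
  ε ℚ.* (M I ℚ.* (s ℚ.* π)) ∎
  where
  open ℚSolver.+-*-Solver using (solve; _:=_; _:*_)
  σs = Vec.zipWith (insert p) I ρs
  ε = -1ℤ ^ indexSum I / 1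
  s = sign (compose ρs) / 1
  π = ∏ λ i → minor M I (Vec.map (_⟨$⟩ʳ i) ρs)

-- Serves as a partition of unity: multiplying a term of `Det` by this sum, taken for σ₁, assigns
-- the term to the position where σ₁ takes the value `i₁`.
∑-preimage : (σ : Permutation′ n) (i : Fin n) → ∑ (List.allFin n) (λ p → 𝟙 ((σ ⟨$⟩ʳ p) Fin.≟ i)) ≡ 1ℚ
∑-preimage {n} σ i = trans
  (∑-cong (List.allFin n) λ p → 𝟙-cong ((σ ⟨$⟩ʳ p) Fin.≟ i) (p Fin.≟ (σ Perm.⟨$⟩ˡ i))
    (λ eq → trans (sym (Perm.inverseˡ σ)) (cong (σ Perm.⟨$⟩ˡ_) eq))
    (λ eq → trans (cong (σ ⟨$⟩ʳ_) eq) (Perm.inverseʳ σ)))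
  (∑-allFin-𝟙 (σ Perm.⟨$⟩ˡ i))

module _ (k : ℕ) (M : Tensor (2 * suc k) (suc n)) (i₁ : Fin (suc n)) where
  private
    indices = tuples (List.allFin (suc n)) (2 * suc k)
    ρ-tuples = tuples (permutations n) (2 * suc k)
    σ-tuples = tuples (permutations (suc n)) (2 * suc k)

  -- The minor's value is left as an argument `f`, so that one formula serves both the unnormalised
  -- `minorSum` and `Det (minor M I)`; homogeneity in `f` carries 1/n! from outside to inside.
  expansion : (Vec (Fin (suc n)) (2 * suc k) → ℚ) → ℚ
  expansion f = ∑ indices λ I → 𝟙 (Vec.head I Fin.≟ i₁) ℚ.* ((-1ℤ ^ indexSum I / 1) ℚ.* (M I ℚ.* f I))

  minorSum : Vec (Fin (suc n)) (2 * suc k) → ℚ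
  minorSum I = ∑ ρ-tuples (detTerm (minor M I))

  ∑-detTerm-at : (p : Fin (suc n)) →
    ∑ σ-tuples (λ σs → 𝟙 ((Vec.head σs ⟨$⟩ʳ p) Fin.≟ i₁) ℚ.* detTerm M σs) ≡ expansion minorSum
  ∑-detTerm-at p = begin
    ∑ σ-tuples (λ σs → 𝟙 ((Vec.head σs ⟨$⟩ʳ p) Fin.≟ i₁) ℚ.* detTerm M σs)
      ≡⟨ ∑-permutations-insert p (2 * suc k) _ resp ⟩
    ∑ indices (λ I → ∑ ρ-tuples λ ρs →
      𝟙 ((Vec.head (Vec.zipWith (insert p) I ρs) ⟨$⟩ʳ p) Fin.≟ i₁) ℚ.* detTerm M (Vec.zipWith (insert p) I ρs))
      ≡⟨ ∑-cong indices (λ I → ∑-cong ρ-tuples λ ρs →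
           cong₂ (λ i x → 𝟙 (i Fin.≟ i₁) ℚ.* x) (head-insert I ρs) (detTerm-insert (suc k) M p I ρs)) ⟩
    ∑ indices (λ I → ∑ ρ-tuples λ ρs → 𝟙 (Vec.head I Fin.≟ i₁) ℚ.* (ε I ℚ.* (M I ℚ.* detTerm (minor M I) ρs)))
      ≡⟨ ∑-cong indices (λ I → pull (𝟙 (Vec.head I Fin.≟ i₁)) (ε I) (M I) (detTerm (minor M I))) ⟨
    expansion minorSum ∎
    where
    ε : Vec (Fin (suc n)) (2 * suc k) → ℚ
    ε I = -1ℤ ^ indexSum I / 1
    resp : ∀ {σs τs} → Pointwise Perm._≈_ σs τs →
      𝟙 ((Vec.head σs ⟨$⟩ʳ p) Fin.≟ i₁) ℚ.* detTerm M σs ≡ 𝟙 ((Vec.head τs ⟨$⟩ʳ p) Fin.≟ i₁) ℚ.* detTerm M τs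
    resp σs≈τs@(σ≈τ ∷ _) = cong₂ (λ i x → 𝟙 (i Fin.≟ i₁) ℚ.* x) (σ≈τ p) (detTerm-resp M σs≈τs)
    head-insert : ∀ I ρs → Vec.head (Vec.zipWith (insert p) I ρs) ⟨$⟩ʳ p ≡ Vec.head I
    head-insert (i ∷ I) (ρ ∷ ρs) = insert-at p i ρ
    pull : ∀ a b c (f : Vec (Permutation′ n) (2 * suc k) → ℚ) →
      a ℚ.* (b ℚ.* (c ℚ.* ∑ ρ-tuples f)) ≡ ∑ ρ-tuples (λ ρs → a ℚ.* (b ℚ.* (c ℚ.* f ρs)))
    pull a b c f = begin
      a ℚ.* (b ℚ.* (c ℚ.* ∑ ρ-tuples f))
        ≡⟨ cong (λ x → a ℚ.* (b ℚ.* x)) (*-distribˡ-∑ c ρ-tuples f) ⟩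
      a ℚ.* (b ℚ.* ∑ ρ-tuples (λ ρs → c ℚ.* f ρs))
        ≡⟨ cong (a ℚ.*_) (*-distribˡ-∑ b ρ-tuples _) ⟩
      a ℚ.* ∑ ρ-tuples (λ ρs → b ℚ.* (c ℚ.* f ρs))
        ≡⟨ *-distribˡ-∑ a ρ-tuples _ ⟩
      ∑ ρ-tuples (λ ρs → a ℚ.* (b ℚ.* (c ℚ.* f ρs))) ∎

  ∑-detTerm : ∑ σ-tuples (detTerm M) ≡ (+ suc n / 1) ℚ.* expansion minorSum
  ∑-detTerm = begin
    ∑ σ-tuples (detTerm M)
      ≡⟨ ∑-cong σ-tuples (λ σs → trans (sym (ℚ.*-identityˡ (detTerm M σs)))
           (cong (ℚ._* detTerm M σs) (sym (∑-preimage (Vec.head σs) i₁)))) ⟩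
    ∑ σ-tuples (λ σs → ∑ (List.allFin (suc n)) (λ p → 𝟙 ((Vec.head σs ⟨$⟩ʳ p) Fin.≟ i₁)) ℚ.* detTerm M σs)
      ≡⟨ ∑-cong σ-tuples (λ σs → *-distribʳ-∑ (detTerm M σs) (List.allFin (suc n))
           (λ p → 𝟙 ((Vec.head σs ⟨$⟩ʳ p) Fin.≟ i₁))) ⟩
    ∑ σ-tuples (λ σs → ∑ (List.allFin (suc n)) λ p → 𝟙 ((Vec.head σs ⟨$⟩ʳ p) Fin.≟ i₁) ℚ.* detTerm M σs)
      ≡⟨ ∑-swap σ-tuples (List.allFin (suc n)) _ ⟩
    ∑ (List.allFin (suc n)) (λ p → ∑ σ-tuples λ σs → 𝟙 ((Vec.head σs ⟨$⟩ʳ p) Fin.≟ i₁) ℚ.* detTerm M σs)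
      ≡⟨ ∑-cong (List.allFin (suc n)) ∑-detTerm-at ⟩
    ∑ (List.allFin (suc n)) (λ _ → expansion minorSum)
      ≡⟨ ∑-allFin-const (suc n) (expansion minorSum) ⟩
    (+ suc n / 1) ℚ.* expansion minorSum ∎

  *-expansion : ∀ c f → c ℚ.* expansion f ≡ expansion (λ I → c ℚ.* f I)
  *-expansion c f = trans (*-distribˡ-∑ c indices _) (∑-cong indices λ I →
    solve 5 (λ c w e m x → c :* (w :* (e :* (m :* x))) := w :* (e :* (m :* (c :* x)))) refl
      c (𝟙 (Vec.head I Fin.≟ i₁)) (-1ℤ ^ indexSum I / 1) (M I) (f I))
    where open ℚSolver.+-*-Solver using (solve; _:=_; _:*_)

  Det-expansion : Det M ≡ expansion (λ I → Det (minor M I))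
  Det-expansion = begin
    1/[1+n]! ℚ.* ∑ σ-tuples (detTerm M)
      ≡⟨ cong (1/[1+n]! ℚ.*_) ∑-detTerm ⟩
    1/[1+n]! ℚ.* ((+ suc n / 1) ℚ.* expansion minorSum)
      ≡⟨ ℚ.*-assoc 1/[1+n]! (+ suc n / 1) (expansion minorSum) ⟨
    1/[1+n]! ℚ.* (+ suc n / 1) ℚ.* expansion minorSum
      -- `suc n !` unfolds to `suc n * n !`, the form of denominator that this lemma cancels.
      ≡⟨ cong (ℚ._* expansion minorSum) (1/[m*n]*m n (n !) {{n ℕ.!≢0}} {{suc n ℕ.!≢0}}) ⟩
    1/n! ℚ.* expansion minorSum
      ≡⟨ *-expansion 1/n! minorSum ⟩
    expansion (λ I → Det (minor M I)) ∎
    where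
    1/[1+n]! = (1ℤ / (suc n !)) {{suc n ℕ.!≢0}}
    1/n! = (1ℤ / (n !)) {{n ℕ.!≢0}}

-- The minors of `Δ`.

punchIn-≥ : (i : Fin (suc n)) (j : Fin n) → toℕ i ℕ.≤ toℕ j → punchIn i j ≡ suc j
punchIn-≥ zero    j       _           = refl
punchIn-≥ (suc i) (suc j) (ℕ.s≤s i≤j) = cong suc (punchIn-≥ i j i≤j)

punchIn-< : (i : Fin (suc n)) (j : Fin n) → toℕ j ℕ.< toℕ i → punchIn i j ≡ inject₁ j
punchIn-< (suc i) zero    _           = refl
punchIn-< (suc i) (suc j) (ℕ.s≤s j<i) = cong suc (punchIn-< i j j<i)

opposite-inject₁ : (j : Fin n) → opposite (inject₁ j) ≡ suc (opposite j)
opposite-inject₁ zero    = refl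
opposite-inject₁ (suc j) = cong inject₁ (opposite-inject₁ j)

-- The two reversals take place in ranges of different length: `opposite j` has value n - 1 - j but
-- `opposite i` has value n - i. Hence the strict inequality turns into a weak one.
opposite-<⇒≤ : (i : Fin (suc n)) (j : Fin n) → toℕ (opposite j) ℕ.< toℕ (opposite i) → toℕ i ℕ.≤ toℕ j
opposite-<⇒≤ {n} i j oj<oi = ℕ.≮⇒≥ λ j<i → ℕ.<⇒≱
  (subst₂ ℕ._<_ (Fin.opposite-prop j) (Fin.opposite-prop i) oj<oi) (ℕ.∸-monoʳ-≤ n j<i)

opposite-≮⇒> : (i : Fin (suc n)) (j : Fin n) → ¬ toℕ (opposite j) ℕ.< toℕ (opposite i) → toℕ j ℕ.< toℕ i
opposite-≮⇒> i j oj≮oi = ℕ.≰⇒> λ i≤j → oj≮oi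
  (subst₂ ℕ._<_ (sym (Fin.opposite-prop j)) (sym (Fin.opposite-prop i))
    (ℕ.∸-monoʳ-< (ℕ.s≤s i≤j) (Fin.toℕ<n j)))

-- The reason why the two shifts in μ differ by exactly 1. If j ≥ i, then `punchIn i` raises the
-- index by 1 and the entry, lying before the deleted one, is shifted by a = 1 + b. If j < i, the
-- index stays and the entry is shifted by b. Entry plus index changes by b in both cases.
entry-deleteAndShift : ∀ a b (b≤a : b ℤ.≤ a) → a ≡ 1ℤ ℤ.+ b →
  (i : Fin (suc n)) (v : DecreasingVector (suc n)) (j : Fin n) →
  entry (deleteAndShift a b b≤a (opposite i) v) (opposite j) ℤ.+ + suc (toℕ j) ≡
  entry v (opposite (punchIn i j)) ℤ.+ + suc (toℕ (punchIn i j)) ℤ.+ b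
entry-deleteAndShift _ b _ refl i v j with toℕ (opposite j) ℕ.<? toℕ (opposite i)
... | yes oj<oi rewrite punchIn-≥ i j (opposite-<⇒≤ i j oj<oi) =
  solve 3 (λ e b j → e :+ (con 1ℤ :+ b) :+ j := e :+ (con 1ℤ :+ j) :+ b) refl
    (entry v (inject₁ (opposite j))) b (+ suc (toℕ j))
  where open ℤSolver.+-*-Solver using (solve; _:=_; _:+_; con)
... | no oj≮oi rewrite punchIn-< i j (opposite-≮⇒> i j oj≮oi) | opposite-inject₁ j | Fin.toℕ-inject₁ j =
  solve 3 (λ e b j → e :+ b :+ j := e :+ j :+ b) refl (entry v (suc (opposite j))) b (+ suc (toℕ j))
  where open ℤSolver.+-*-Solver using (solve; _:=_; _:+_)

indexSum-∑ℤ : (I : Vec (Fin n) d) → + indexSum I ≡ ∑ℤ λ j → + suc (toℕ (Vec.lookup I j))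
indexSum-∑ℤ []      = refl
indexSum-∑ℤ (i ∷ I) = cong (ℤ._+_ (+ suc (toℕ i))) (indexSum-∑ℤ I)

weightTerm : (Fin d → DecreasingVector n) → Vec (Fin n) d → Fin d → ℤ
weightTerm λs I j = entry (λs j) (opposite (Vec.lookup I j)) ℤ.+ + suc (toℕ (Vec.lookup I j))

weight-∑ℤ : (λs : Fin d → DecreasingVector n) (I : Vec (Fin n) d) → weight λs I ≡ ∑ℤ (weightTerm λs I)
weight-∑ℤ {d = d} λs I = trans (cong (ℤ._+_ (∑ℤ e)) (indexSum-∑ℤ I))
  (sym (∑ℤ-distrib-+ e (λ j → + suc (toℕ (Vec.lookup I j)))))
  where
  e : Fin d → ℤ
  e j = entry (λs j) (opposite (Vec.lookup I j))

module _ (k-1 : ℕ) (λs : Fin (2 * suc k-1) → DecreasingVector (suc n)) where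
  private
    -- Equal to -(2k - 1), the change of `target` when n drops by 1, as `target` is linear in n with
    -- slope 2k - 1. The first vector alone carries it: its b is `shift`, and the b of all the
    -- others is 0.
    shift : ℤ
    shift = ℤ.- (+ 2 ℤ.* + k-1) ℤ.- 1ℤ

  weightTerm-μ-zero : ∀ I J →
    weightTerm (μ k-1 λs I) J zero ≡ weightTerm λs (Vec.zipWith punchIn I J) zero ℤ.+ shift
  weightTerm-μ-zero I J rewrite Vec.lookup-zipWith punchIn zero I J =
    entry-deleteAndShift c shift (ℤ.i-j≤i c 1ℤ)
      (solve 1 (λ c → c := con 1ℤ :+ (c :- con 1ℤ)) refl c) (Vec.lookup I zero) (λs zero) (Vec.lookup J zero)
    where
    open ℤSolver.+-*-Solver using (solve; _:=_; _:+_; _:-_; con)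
    c = ℤ.- (+ 2 ℤ.* + k-1)

  weightTerm-μ-suc : ∀ I J j →
    weightTerm (μ k-1 λs I) J (suc j) ≡ weightTerm λs (Vec.zipWith punchIn I J) (suc j)
  weightTerm-μ-suc I J j rewrite Vec.lookup-zipWith punchIn (suc j) I J = trans
    (entry-deleteAndShift 1ℤ (+ 0) (ℤ.+≤+ ℕ.z≤n) refl (Vec.lookup I (suc j)) (λs (suc j)) (Vec.lookup J (suc j)))
    (ℤ.+-identityʳ _)

  weight-μ : ∀ I J → weight (μ k-1 λs I) J ≡ weight λs (Vec.zipWith punchIn I J) ℤ.+ shift
  weight-μ I J = begin
    weight (μ k-1 λs I) J
      ≡⟨ weight-∑ℤ (μ k-1 λs I) J ⟩
    weightTerm (μ k-1 λs I) J zero ℤ.+ ∑ℤ (λ j → weightTerm (μ k-1 λs I) J (suc j))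
      ≡⟨ cong₂ ℤ._+_ (weightTerm-μ-zero I J) (∑ℤ-cong (weightTerm-μ-suc I J)) ⟩
    w zero ℤ.+ shift ℤ.+ ∑ℤ (λ j → w (suc j))
      ≡⟨ solve 3 (λ a b c → a :+ b :+ c := a :+ c :+ b) refl (w zero) shift (∑ℤ λ j → w (suc j)) ⟩
    w zero ℤ.+ ∑ℤ (λ j → w (suc j)) ℤ.+ shift
      ≡⟨ cong (ℤ._+ shift) (weight-∑ℤ λs (Vec.zipWith punchIn I J)) ⟨
    weight λs (Vec.zipWith punchIn I J) ℤ.+ shift ∎
    where
    open ℤSolver.+-*-Solver using (solve; _:=_; _:+_)
    w = weightTerm λs (Vec.zipWith punchIn I J)

  target-suc : target (suc k-1) n ≡ target (suc k-1) (suc n) ℤ.+ shift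
  target-suc = solve 2
    (λ k n → (con (+ 2) :* (con 1ℤ :+ k) :- con 1ℤ) :* n :+ con 1ℤ
          := (con (+ 2) :* (con 1ℤ :+ k) :- con 1ℤ) :* (con 1ℤ :+ n) :+ con 1ℤ
             :+ (:- (con (+ 2) :* k) :- con 1ℤ))
    refl (+ k-1) (+ n)
    where open ℤSolver.+-*-Solver using (solve; _:=_; _:+_; _:*_; _:-_; :-_; con)

  -- Both sides are indicators of an equation between a weight and a target. Passing to μ adds
  -- `shift` to the weight and to the target, and cancelling it gives the converse.
  minor-Δ : ∀ I J → minor (Δ (suc k-1) λs) I J ≡ Δ (suc k-1) (μ k-1 λs I) J
  minor-Δ I J = 𝟙-cong (weight λs IJ ℤ.≟ target (suc k-1) (suc n))
    (weight (μ k-1 λs I) J ℤ.≟ target (suc k-1) n)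
    (λ eq → trans (weight-μ I J) (trans (cong (ℤ._+ shift) eq) (sym target-suc)))
    (λ eq → ∙-cancelʳ shift _ _ (trans (sym (weight-μ I J)) (trans eq target-suc)))
    where IJ = Vec.zipWith punchIn I J

corollary4p8 : ∀ (n-1 k-1 : ℕ)
    (λs : Fin (2 * suc k-1) → DecreasingVector (suc n-1)) (i₁ : Fin (suc n-1)) →
    𝔇 (suc k-1) λs ≡
    ∑ (admissible k-1 λs i₁) (λ I →
    ((-1ℤ ^ indexSum I) / 1) ℚ.* 𝔇 (suc k-1) (μ k-1 λs I))
corollary4p8 n-1 k-1 λs i₁ = begin
  Det M
    ≡⟨ Det-expansion k-1 M i₁ ⟩
  ∑ indices (λ I → 𝟙 (Vec.head I Fin.≟ i₁) ℚ.* (ε I ℚ.* (M I ℚ.* Det (minor M I))))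
    ≡⟨ ∑-cong indices (λ I → trans
         (cong (λ x → 𝟙 (Vec.head I Fin.≟ i₁) ℚ.* (ε I ℚ.* (M I ℚ.* x))) (Det-cong (minor-Δ k-1 λs I)))
         (solve 4 (λ w e m x → w :* (e :* (m :* x)) := w :* m :* (e :* x)) refl
           (𝟙 (Vec.head I Fin.≟ i₁)) (ε I) (M I) (𝔇 (suc k-1) (μ k-1 λs I)))) ⟩
  ∑ indices (λ I → 𝟙 (Vec.head I Fin.≟ i₁) ℚ.* M I ℚ.* (ε I ℚ.* 𝔇 (suc k-1) (μ k-1 λs I)))
    -- `M I` is by definition the indicator of the weight equation; together with the indicator of
    -- the first entry it forms the filter of `admissible`.
    ≡⟨ ∑-cong indices (λ I → cong (ℚ._* (ε I ℚ.* 𝔇 (suc k-1) (μ k-1 λs I)))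
         (𝟙-× (Vec.head I Fin.≟ i₁) (weight λs I ℤ.≟ target (suc k-1) (suc n-1)))) ⟨
  ∑ indices (λ I → 𝟙 ((Vec.head I Fin.≟ i₁) ×-dec (weight λs I ℤ.≟ target (suc k-1) (suc n-1)))
                   ℚ.* (ε I ℚ.* 𝔇 (suc k-1) (μ k-1 λs I)))
    ≡⟨ ∑-filter (λ I → (Vec.head I Fin.≟ i₁) ×-dec (weight λs I ℤ.≟ target (suc k-1) (suc n-1))) indices _ ⟨
  ∑ (admissible k-1 λs i₁) (λ I → ε I ℚ.* 𝔇 (suc k-1) (μ k-1 λs I)) ∎
  where
  open ℚSolver.+-*-Solver using (solve; _:=_; _:*_)
  M = Δ (suc k-1) λs
  indices = tuples (List.allFin (suc n-1)) (2 * suc k-1)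
  ε : Vec (Fin (suc n-1)) (2 * suc k-1) → ℚ
  ε I = -1ℤ ^ indexSum I / 1
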